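{- Let $\alpha,\beta$ be real (or complex) parameters and let $k,m,s$ be non-negative integers with $s\le k$. Then $$\genfrac{\lfloor}{\rfloor}{0pt}{}{k+m}{k}^{\alpha,\beta}=\sum_{j=0}^{s}\left(\sum_{k-j\le i_1\le i_2\le\cdots\le i_{s-j}\le k}\ \prod_{l=0}^{s-j-1}\Big((\alpha+\beta)i_{l+1}+\alpha\big(m-(s-j-l)\big)\Big)\right)\genfrac{\lfloor}{\rfloor}{0pt}{}{k+m-s}{k-j}^{\alpha,\beta},$$ where, for $j=s$, the inner sum is over the empty tuple and equals $1$ (empty product).
   Context: For parameters $\alpha,\beta$, the generalized Stirling numbers $\genfrac{\lfloor}{\rfloor}{0pt}{}{n}{k}^{\alpha,\beta}$, $0\le k\le n$, are defined by the polynomial identity in $x$ $$x(x+\alpha)\cdots(x+(n-1)\alpha)=\sum_{k=0}^{n}\genfrac{\lfloor}{\rfloor}{0pt}{}{n}{k}^{\alpha,\beta}\,x(x-\beta)\cdots(x-(k-1)\beta),$$ (empty products equal $1$), and $\genfrac{\lfloor}{\rfloor}{0pt}{}{n}{k}^{\alpha,\beta}=0$ for $n<0$, $k<0$ or $k>n$. -}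

module Defs where

open import Algebra.Bundles using (CommutativeRing)
open import Data.Fin.Base using (Fin; toℕ)
open import Data.List.Base using (List; []; _∷_; map; concatMap; foldr; upTo)
open import Data.Nat.Base as ℕ using (ℕ; zero; suc)
open import Data.Vec.Base as Vec using (Vec)
open import Level using (_⊔_)

-- lo, lo + 1, …, hi
range : ℕ → ℕ → List ℕ
range lo hi = map (lo ℕ.+_) (upTo (suc hi ℕ.∸ lo))

-- All (i₁, …, iᵣ) with lo ≤ i₁ ≤ ⋯ ≤ iᵣ ≤ hi.
increasingTuples : (r lo hi : ℕ) → List (Vec ℕ r)
increasingTuples zero    lo hi = Vec.[] ∷ []
increasingTuples (suc r) lo hi =
  concatMap (λ i → map (i Vec.∷_) (increasingTuples r i hi)) (range lo hi)

-- The parameters are elements of an arbitrary commutative ring, ℝ and ℂ being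
-- instances.
module GeneralizedStirling {c ℓ} (R : CommutativeRing c ℓ) where

  open CommutativeRing R

  open import Algebra.Properties.Semiring.Sum semiring public
    using (sum-syntax; sum⁺-syntax)
  open import Algebra.Properties.Semiring.Mult semiring public using (_×_)
  open import Algebra.Definitions.RawMonoid *-rawMonoid public
    using () renaming (sum to product)

  infixl 10 prod-syntax

  prod-syntax : ∀ n → (Fin n → Carrier) → Carrier
  prod-syntax _ = product

  syntax prod-syntax n (λ i → x) = ∏[ i < n ] x

  sumOver : ∀ {a} {A : Set a} → List A → (A → Carrier) → Carrier
  sumOver xs f = foldr (λ a acc → f a + acc) 0# xs

  ι : ℕ → Carrier
  ι n = n × 1#

  -- Formal polynomials a₀ ∷ a₁ ∷ …, constant coefficient first; trailing zeros
  -- are allowed, so equality is coefficientwise. An identity of polynomial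
  -- functions would not determine coefficients over an arbitrary ring.

  Poly : Set c
  Poly = List Carrier

  coeff : Poly → ℕ → Carrier
  coeff []      _       = 0#
  coeff (a ∷ p) zero    = a
  coeff (a ∷ p) (suc i) = coeff p i

  infix  4 _≈ₚ_
  infixl 6 _+ₚ_
  infixl 7 _*ₚ_ _·ₚ_

  _≈ₚ_ : Poly → Poly → Set ℓ
  p ≈ₚ q = ∀ i → coeff p i ≈ coeff q i

  _+ₚ_ : Poly → Poly → Poly
  []      +ₚ q       = q
  (a ∷ p) +ₚ []      = a ∷ p
  (a ∷ p) +ₚ (b ∷ q) = (a + b) ∷ (p +ₚ q)

  _·ₚ_ : Carrier → Poly → Poly
  a ·ₚ p = map (a *_) p

  _*ₚ_ : Poly → Poly → Poly
  []      *ₚ q = []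
  (a ∷ p) *ₚ q = (a ·ₚ q) +ₚ (0# ∷ (p *ₚ q))

  1ₚ : Poly
  1ₚ = 1# ∷ []

  x+_ : Carrier → Poly
  x+ a = a ∷ 1# ∷ []

  -- x (x + α) ⋯ (x + (n - 1) α)
  rising : Carrier → ℕ → Poly
  rising α zero    = 1ₚ
  rising α (suc n) = rising α n *ₚ (x+ (ι n * α))

  -- x (x - β) ⋯ (x - (k - 1) β)
  falling : Carrier → ℕ → Poly
  falling β zero    = 1ₚ
  falling β (suc k) = falling β k *ₚ (x+ (- (ι k * β)))

  -- a 0 · p 0 + ⋯ + a n · p n
  linComb : ℕ → (ℕ → Carrier) → (ℕ → Poly) → Poly
  linComb zero    a p = a 0 ·ₚ p 0
  linComb (suc n) a p = linComb n a p +ₚ (a (suc n) ·ₚ p (suc n))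

  -- The falling products are monic of degrees 0, 1, 2, …, so these conditions
  -- are satisfied by exactly one S up to ≈.
  -- Indices are natural numbers: for s ≤ k and j ≤ s the indices k + m - s and
  -- k - j are never negative, so the zero convention is needed only for k > n.
  record IsGeneralizedStirling (α β : Carrier) (S : ℕ → ℕ → Carrier)
         : Set (c ⊔ ℓ) where
    field
      expansion : ∀ n → rising α n ≈ₚ linComb n (S n) (falling β)
      vanishing : ∀ {n k} → n ℕ.< k → S n k ≈ 0#

  -- The vector is indexed from 0, so lookup t l is i_{l+1}. Since l < r, r ∸ l is
  -- the true difference; m - (r - l) may be negative and is formed in the ring.
  weight : (α β : Carrier) (m r : ℕ) → Vec ℕ r → Carrier
  weight α β m r t =
    ∏[ l < r ] ((α + β) * ι (Vec.lookup t l) + α * (ι m - ι (r ℕ.∸ toℕ l)))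

{-# OPTIONS --safe #-}
module Submission where

-- Comparing coefficients of the falling products, which are monic of increasing
-- degree, gives S(n+1, k) = S(n, k-1) + (nα + kβ) S(n, k). The identity follows by
-- induction on s, applying this recurrence to every term of the sum. With W(r, lo)
-- the sum of the weights of the r-tuples between lo and k, the new coefficients
-- are correct because splitting the tuples by whether i₁ = lo gives
-- W(r+1, lo) = ((α+β)lo + α(m-r-1)) W(r, lo) + W(r+1, lo+1).

open import Algebra.Bundles using (CommutativeRing)
open import Data.Fin.Base using (toℕ)
open import Data.Fin.Properties using (toℕ-fromℕ; toℕ-inject₁; toℕ≤pred[n])
open import Data.List.Base using (List; []; _∷_; _++_; map; applyUpTo; upTo)
open import Data.List.Properties using (map-upTo)
open import Data.Nat.Base as ℕ using (ℕ; zero; suc; s≤s; _∸_)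
import Data.Nat.Properties as ℕ
open import Data.Nat.Solver using (module +-*-Solver)
open import Data.Sum.Base using (inj₁; inj₂)
import Data.Vec.Base as Vec
open import Function.Base using (_∘_)
open import Relation.Binary.PropositionalEquality as ≡ using (_≡_)
open import Defs

-- Integer intervals and index arithmetic.

applyUpTo-cong : ∀ {a} {A : Set a} {f g : ℕ → A} → (∀ i → f i ≡ g i) →
                 ∀ n → applyUpTo f n ≡ applyUpTo g n
applyUpTo-cong f≡g zero    = ≡.refl
applyUpTo-cong f≡g (suc n) = ≡.cong₂ _∷_ (f≡g 0) (applyUpTo-cong (f≡g ∘ suc) n)

-- With `lo` at most `hi`, `suc hi ∸ lo` is a successor, so `upTo` yields a first element. This is
-- what separates the tuples with i₁ = `lo` from the rest.
range-∷ : ∀ {lo hi} → lo ℕ.≤ hi → range lo hi ≡ lo ∷ range (suc lo) hi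
range-∷ {lo} {hi} lo≤hi = begin
  map (lo ℕ.+_) (upTo (suc hi ∸ lo))    ≡⟨ ≡.cong (map (lo ℕ.+_) ∘ upTo) (ℕ.+-∸-assoc 1 lo≤hi) ⟩
  map (lo ℕ.+_) (upTo (suc (hi ∸ lo)))  ≡⟨ map-upTo (lo ℕ.+_) (suc (hi ∸ lo)) ⟩
  lo ℕ.+ 0 ∷ applyUpTo (λ i → lo ℕ.+ suc i) (hi ∸ lo)
    ≡⟨ ≡.cong₂ _∷_ (ℕ.+-identityʳ lo) (applyUpTo-cong (ℕ.+-suc lo) (hi ∸ lo)) ⟩
  lo ∷ applyUpTo (suc lo ℕ.+_) (hi ∸ lo)  ≡⟨ ≡.cong (lo ∷_) (map-upTo (suc lo ℕ.+_) (hi ∸ lo)) ⟨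
  lo ∷ range (suc lo) hi                  ∎
  where open ≡.≡-Reasoning

range-empty : ∀ hi → range (suc hi) hi ≡ []
range-empty hi rewrite ℕ.n∸n≡0 hi = ≡.refl

-- Adding j to either side gives k + m. With N = k + m - (s + 1) and i = k - j, this is the relation
-- under which the factor of a first entry i in a tuple of length s - j + 1 equals the recurrence
-- coefficient Nα + iβ.
index-balance : ∀ {k s j} m → suc s ℕ.≤ k → j ℕ.≤ s →
                (k ∸ j) ℕ.+ m ≡ (k ℕ.+ m ∸ suc s) ℕ.+ suc (s ∸ j)
index-balance {k} {s} {j} m s<k j≤s = ℕ.+-cancelʳ-≡ j _ _ (begin
  (k ∸ j) ℕ.+ m ℕ.+ j   ≡⟨ solve 3 (λ a m j → a :+ m :+ j := a :+ j :+ m) ≡.refl (k ∸ j) m j ⟩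
  (k ∸ j) ℕ.+ j ℕ.+ m   ≡⟨ ≡.cong (ℕ._+ m) (ℕ.m∸n+n≡m (ℕ.≤-trans j≤s (ℕ.<⇒≤ s<k))) ⟩
  k ℕ.+ m               ≡⟨ ℕ.m∸n+n≡m (ℕ.≤-trans s<k (ℕ.m≤m+n k m)) ⟨
  N ℕ.+ suc s           ≡⟨ ≡.cong (λ t → N ℕ.+ suc t) (ℕ.m∸n+n≡m j≤s) ⟨
  N ℕ.+ (suc (s ∸ j) ℕ.+ j)  ≡⟨ ℕ.+-assoc N _ j ⟨
  N ℕ.+ suc (s ∸ j) ℕ.+ j    ∎)
  where
  open ≡.≡-Reasoning
  open +-*-Solver using (solve; _:=_; _:+_)
  N : ℕ
  N = k ℕ.+ m ∸ suc s

module _ {c ℓ} (R : CommutativeRing c ℓ) where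

  open CommutativeRing R hiding (zero)
  open GeneralizedStirling R
  open import Algebra.Properties.Monoid.Mult +-monoid using (×-homo-+)
  open import Algebra.Properties.Semiring.Sum semiring
    using (sum-cong-≋; sum-init-last; ∑-distrib-+)
  open import Relation.Binary.Reasoning.Setoid setoid

  open import Algebra.Solver.Ring.NaturalCoefficients.Default commutativeSemiring
    using (solve; _:=_; _:+_; _:*_)

  -- Coefficients of sums, scalar multiples and products with x + a.

  coeff-+ : ∀ p q i → coeff (p +ₚ q) i ≈ coeff p i + coeff q i
  coeff-+ []      q       i       = sym (+-identityˡ _)
  coeff-+ (a ∷ p) []      i       = sym (+-identityʳ _)
  coeff-+ (a ∷ p) (b ∷ q) zero    = refl
  coeff-+ (a ∷ p) (b ∷ q) (suc i) = coeff-+ p q i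

  coeff-· : ∀ a p i → coeff (a ·ₚ p) i ≈ a * coeff p i
  coeff-· a []      i       = sym (zeroʳ a)
  coeff-· a (b ∷ p) zero    = refl
  coeff-· a (b ∷ p) (suc i) = coeff-· a p i

  -- Multiplication by x.
  shift : Poly → Poly
  shift p = 0# ∷ p

  -- This is p(x + a) = ap + xp read coefficientwise. Since `*ₚ` recurses on its left factor and the
  -- linear factor stands on the right, it takes an induction on p.
  coeff-*-x+ : ∀ p a i → coeff (p *ₚ (x+ a)) i ≈ a * coeff p i + coeff (shift p) i
  coeff-*-x+ []      a zero    = sym (trans (+-identityʳ _) (zeroʳ a))
  coeff-*-x+ []      a (suc i) = sym (trans (+-identityʳ _) (zeroʳ a))
  coeff-*-x+ (b ∷ p) a zero    = +-congʳ (*-comm b a)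
  coeff-*-x+ (b ∷ p) a (suc i) = begin
    coeff ((b * 1# ∷ []) +ₚ (p *ₚ (x+ a))) i            ≈⟨ coeff-+ (b * 1# ∷ []) (p *ₚ (x+ a)) i ⟩
    coeff (b * 1# ∷ []) i + coeff (p *ₚ (x+ a)) i       ≈⟨ +-congˡ (coeff-*-x+ p a i) ⟩
    coeff (b * 1# ∷ []) i + (a * coeff p i + coeff (shift p) i) ≈⟨ constant i ⟩
    a * coeff p i + coeff (b ∷ p) i                     ∎
    where
    constant : ∀ i → coeff (b * 1# ∷ []) i + (a * coeff p i + coeff (shift p) i)
                       ≈ a * coeff p i + coeff (b ∷ p) i
    constant zero    = trans (+-cong (*-identityʳ b) (+-identityʳ _)) (+-comm b _)
    constant (suc i) = +-identityˡ _

  shift-cong : ∀ {p q} → p ≈ₚ q → shift p ≈ₚ shift q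
  shift-cong p≈q zero    = refl
  shift-cong p≈q (suc i) = p≈q i

  shift-+· : ∀ p a q i → coeff (shift (p +ₚ (a ·ₚ q))) i ≈ coeff (shift p) i + a * coeff (shift q) i
  shift-+· p a q zero    = sym (trans (+-identityˡ _) (zeroʳ a))
  shift-+· p a q (suc i) = trans (coeff-+ p (a ·ₚ q) i) (+-congˡ (coeff-· a q i))

  shift-· : ∀ a q i → coeff (shift (a ·ₚ q)) i ≈ a * coeff (shift q) i
  shift-· a q zero    = sym (zeroʳ a)
  shift-· a q (suc i) = coeff-· a q i

  *-x+-cong : ∀ {p q} a → p ≈ₚ q → (p *ₚ (x+ a)) ≈ₚ (q *ₚ (x+ a))
  *-x+-cong {p} {q} a p≈q i = begin
    coeff (p *ₚ (x+ a)) i              ≈⟨ coeff-*-x+ p a i ⟩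
    a * coeff p i + coeff (shift p) i  ≈⟨ +-cong (*-congˡ (p≈q i)) (shift-cong {p} {q} p≈q i) ⟩
    a * coeff q i + coeff (shift q) i  ≈⟨ coeff-*-x+ q a i ⟨
    coeff (q *ₚ (x+ a)) i              ∎

  coeff-linComb-suc : ∀ n a p i →
    coeff (linComb (suc n) a p) i ≈ coeff (linComb n a p) i + a (suc n) * coeff (p (suc n)) i
  coeff-linComb-suc n a p i =
    trans (coeff-+ (linComb n a p) _ i) (+-congˡ (coeff-· (a (suc n)) (p (suc n)) i))

  -- Falling products: independence, and multiplication by x + γ.

  module _ (β : Carrier) where

    F : ℕ → Poly
    F = falling β

    falling-vanishes : ∀ {k i} → k ℕ.< i → coeff (F k) i ≈ 0#
    falling-vanishes {zero}  {suc i} _         = refl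
    falling-vanishes {suc k} {suc i} (s≤s k<i) = begin
      coeff (F (suc k)) (suc i)                          ≈⟨ coeff-*-x+ (F k) _ (suc i) ⟩
      - (ι k * β) * coeff (F k) (suc i) + coeff (F k) i
        ≈⟨ +-cong (*-congˡ (falling-vanishes (ℕ.m≤n⇒m≤1+n k<i))) (falling-vanishes k<i) ⟩
      - (ι k * β) * 0# + 0#                              ≈⟨ trans (+-identityʳ _) (zeroʳ _) ⟩
      0#                                                 ∎

    falling-monic : ∀ k → coeff (F k) k ≈ 1#
    falling-monic zero    = refl
    falling-monic (suc k) = begin
      coeff (F (suc k)) (suc k)                          ≈⟨ coeff-*-x+ (F k) _ (suc k) ⟩
      - (ι k * β) * coeff (F k) (suc k) + coeff (F k) k
        ≈⟨ +-cong (*-congˡ (falling-vanishes (ℕ.n<1+n k))) (falling-monic k) ⟩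
      - (ι k * β) * 0# + 1#                              ≈⟨ trans (+-congʳ (zeroʳ _)) (+-identityˡ _) ⟩
      1#                                                 ∎

    linComb-vanishes : ∀ n a {i} → n ℕ.< i → coeff (linComb n a F) i ≈ 0#
    linComb-vanishes zero    a {i} n<i = begin
      coeff (a 0 ·ₚ F 0) i  ≈⟨ coeff-· (a 0) (F 0) i ⟩
      a 0 * coeff (F 0) i   ≈⟨ *-congˡ (falling-vanishes n<i) ⟩
      a 0 * 0#              ≈⟨ zeroʳ _ ⟩
      0#                    ∎
    linComb-vanishes (suc n) a {i} n<i = begin
      coeff (linComb (suc n) a F) i                             ≈⟨ coeff-linComb-suc n a F i ⟩
      coeff (linComb n a F) i + a (suc n) * coeff (F (suc n)) i
        ≈⟨ +-cong (linComb-vanishes n a (ℕ.<⇒≤ n<i)) (*-congˡ (falling-vanishes n<i)) ⟩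
      0# + a (suc n) * 0#                                       ≈⟨ trans (+-identityˡ _) (zeroʳ _) ⟩
      0#                                                        ∎

    -- All terms below the top one have degree less than n, and the top one is monic.
    linComb-leading : ∀ n a → coeff (linComb n a F) n ≈ a n
    linComb-leading zero    a = *-identityʳ (a 0)
    linComb-leading (suc n) a = begin
      coeff (linComb (suc n) a F) (suc n)  ≈⟨ coeff-linComb-suc n a F (suc n) ⟩
      coeff (linComb n a F) (suc n) + a (suc n) * coeff (F (suc n)) (suc n)
        ≈⟨ +-cong (linComb-vanishes n a (ℕ.n<1+n n)) (*-congˡ (falling-monic (suc n))) ⟩
      0# + a (suc n) * 1#                  ≈⟨ trans (+-identityˡ _) (*-identityʳ _) ⟩
      a (suc n)                            ∎

    leading-injective : ∀ n {a b} → linComb n a F ≈ₚ linComb n b F → a n ≈ b n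
    leading-injective n {a} {b} a≈b = begin
      a n                      ≈⟨ linComb-leading n a ⟨
      coeff (linComb n a F) n  ≈⟨ a≈b n ⟩
      coeff (linComb n b F) n  ≈⟨ linComb-leading n b ⟩
      b n                      ∎

    -- Descending induction: the leading coefficients agree, so the top terms cancel and the
    -- combinations of length n - 1 remain equal. Monicity makes this work over any commutative
    -- ring.
    linComb-injective : ∀ n {a b} → linComb n a F ≈ₚ linComb n b F →
                        ∀ {k} → k ℕ.≤ n → a k ≈ b k
    linComb-injective n a≈b k≤n with ℕ.m≤n⇒m<n∨m≡n k≤n
    ... | inj₂ ≡.refl = leading-injective n a≈b
    linComb-injective (suc n) {a} {b} a≈b k≤1+n | inj₁ (s≤s k≤n) =
      linComb-injective n init k≤n
      where
      open import Algebra.Properties.Group +-group using (∙-cancelʳ)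
      init : linComb n a F ≈ₚ linComb n b F
      init i = ∙-cancelʳ (b (suc n) * coeff (F (suc n)) i) _ _ (begin
        coeff (linComb n a F) i + b (suc n) * coeff (F (suc n)) i
          ≈⟨ +-congˡ (*-congʳ (leading-injective (suc n) a≈b)) ⟨
        coeff (linComb n a F) i + a (suc n) * coeff (F (suc n)) i  ≈⟨ coeff-linComb-suc n a F i ⟨
        coeff (linComb (suc n) a F) i                              ≈⟨ a≈b i ⟩
        coeff (linComb (suc n) b F) i                              ≈⟨ coeff-linComb-suc n b F i ⟩
        coeff (linComb n b F) i + b (suc n) * coeff (F (suc n)) i  ∎)

    -- The coordinates of (x + γ) Σ aₖ Fₖ: one has (x + γ) Fₖ = Fₖ₊₁ + (γ + kβ) Fₖ.
    next : Carrier → (ℕ → Carrier) → ℕ → Carrier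
    next γ a zero    = (γ + ι 0 * β) * a 0
    next γ a (suc k) = a k + (γ + ι (suc k) * β) * a (suc k)

    falling-suc : ∀ γ k i → γ * coeff (F k) i + coeff (shift (F k)) i
                              ≈ coeff (F (suc k)) i + (γ + ι k * β) * coeff (F k) i
    falling-suc γ k i = begin
      γ * coeff (F k) i + coeff (shift (F k)) i
        ≈⟨ rearrange γ (ι k * β) (coeff (F k) i) (coeff (shift (F k)) i) ⟩
      - (ι k * β) * coeff (F k) i + coeff (shift (F k)) i + (γ + ι k * β) * coeff (F k) i
        ≈⟨ +-congʳ (coeff-*-x+ (F k) _ i) ⟨
      coeff (F (suc k)) i + (γ + ι k * β) * coeff (F k) i ∎
      where
      rearrange : ∀ γ b u v → γ * u + v ≈ - b * u + v + (γ + b) * u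
      rearrange γ b u v = begin
        -- The solver works over commutative semirings, so 0 = (- b + b)u is inserted by hand and
        -- `- b` is then passed as an independent variable `b′`.
        γ * u + v                     ≈⟨ trans (+-congˡ (trans (*-congʳ (-‿inverseˡ b)) (zeroˡ u))) (+-identityʳ _) ⟨
        γ * u + v + (- b + b) * u
          ≈⟨ solve 5 (λ γ b b′ u v → γ :* u :+ v :+ (b′ :+ b) :* u
                                       := b′ :* u :+ v :+ (γ :+ b) :* u) refl γ b (- b) u v ⟩
        - b * u + v + (γ + b) * u     ∎

    -- Multiplication raises the degree by one. The Fₙ₊₁ term is kept apart because
    -- `next γ a (suc n)` also involves `a (suc n)`, which the left side does not contain.
    linComb-*-x+ : ∀ γ n a i → coeff (linComb n a F *ₚ (x+ γ)) i
                     ≈ coeff (linComb n (next γ a) F) i + a n * coeff (F (suc n)) i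
    linComb-*-x+ γ zero a i = begin
      coeff ((a 0 ·ₚ F 0) *ₚ (x+ γ)) i  ≈⟨ coeff-*-x+ (a 0 ·ₚ F 0) γ i ⟩
      γ * coeff (a 0 ·ₚ F 0) i + coeff (shift (a 0 ·ₚ F 0)) i
        ≈⟨ +-cong (*-congˡ (coeff-· (a 0) (F 0) i)) (shift-· (a 0) (F 0) i) ⟩
      γ * (a 0 * coeff (F 0) i) + a 0 * coeff (shift (F 0)) i
        ≈⟨ factor γ (a 0) _ _ ⟩
      a 0 * (γ * coeff (F 0) i + coeff (shift (F 0)) i)
        ≈⟨ *-congˡ (falling-suc γ 0 i) ⟩
      a 0 * (coeff (F 1) i + (γ + ι 0 * β) * coeff (F 0) i)
        ≈⟨ expand (a 0) _ _ _ ⟩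
      (γ + ι 0 * β) * a 0 * coeff (F 0) i + a 0 * coeff (F 1) i
        ≈⟨ +-congʳ (coeff-· (next γ a 0) (F 0) i) ⟨
      coeff (next γ a 0 ·ₚ F 0) i + a 0 * coeff (F 1) i ∎
      where
      factor : ∀ γ a u v → γ * (a * u) + a * v ≈ a * (γ * u + v)
      factor = solve 4 (λ γ a u v → γ :* (a :* u) :+ a :* v := a :* (γ :* u :+ v)) refl
      expand : ∀ a g u v → a * (u + g * v) ≈ g * a * v + a * u
      expand = solve 4 (λ a g u v → a :* (u :+ g :* v) := g :* a :* v :+ a :* u) refl
    linComb-*-x+ γ (suc n) a i = begin
      coeff (linComb (suc n) a F *ₚ (x+ γ)) i  ≈⟨ coeff-*-x+ (linComb (suc n) a F) γ i ⟩
      γ * coeff (linComb (suc n) a F) i + coeff (shift (linComb (suc n) a F)) i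
        ≈⟨ +-cong (*-congˡ (coeff-linComb-suc n a F i))
                  (shift-+· (linComb n a F) (a (suc n)) (F (suc n)) i) ⟩
      γ * (coeff (linComb n a F) i + a (suc n) * coeff (F (suc n)) i)
        + (coeff (shift (linComb n a F)) i + a (suc n) * coeff (shift (F (suc n))) i)
        ≈⟨ factor γ _ (a (suc n)) _ _ _ ⟩
      (γ * coeff (linComb n a F) i + coeff (shift (linComb n a F)) i)
        + a (suc n) * (γ * coeff (F (suc n)) i + coeff (shift (F (suc n))) i)
        ≈⟨ +-cong (sym (coeff-*-x+ (linComb n a F) γ i)) (*-congˡ (falling-suc γ (suc n) i)) ⟩
      coeff (linComb n a F *ₚ (x+ γ)) i
        + a (suc n) * (coeff (F (suc (suc n))) i + (γ + ι (suc n) * β) * coeff (F (suc n)) i)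
        ≈⟨ +-congʳ (linComb-*-x+ γ n a i) ⟩
      coeff (linComb n (next γ a) F) i + a n * coeff (F (suc n)) i
        + a (suc n) * (coeff (F (suc (suc n))) i + (γ + ι (suc n) * β) * coeff (F (suc n)) i)
        ≈⟨ collect _ (a n) _ (a (suc n)) _ _ ⟩
      coeff (linComb n (next γ a) F) i + next γ a (suc n) * coeff (F (suc n)) i
        + a (suc n) * coeff (F (suc (suc n))) i
        ≈⟨ +-congʳ (coeff-linComb-suc n (next γ a) F i) ⟨
      coeff (linComb (suc n) (next γ a) F) i + a (suc n) * coeff (F (suc (suc n))) i ∎
      where
      factor : ∀ γ p b q p′ q′ → γ * (p + b * q) + (p′ + b * q′) ≈ (γ * p + p′) + b * (γ * q + q′)
      factor = solve 6 (λ γ p b q p′ q′ → γ :* (p :+ b :* q) :+ (p′ :+ b :* q′)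
                         := (γ :* p :+ p′) :+ b :* (γ :* q :+ q′)) refl
      collect : ∀ p a q b r g → p + a * q + b * (r + g * q) ≈ p + (a + g * b) * q + b * r
      collect = solve 6 (λ p a q b r g → p :+ a :* q :+ b :* (r :+ g :* q)
                          := p :+ (a :+ g :* b) :* q :+ b :* r) refl

  -- Finite sums.

  sumOver-++ : ∀ {a} {A : Set a} (xs ys : List A) f →
               sumOver (xs ++ ys) f ≈ sumOver xs f + sumOver ys f
  sumOver-++ []       ys f = sym (+-identityˡ _)
  sumOver-++ (x ∷ xs) ys f = trans (+-congˡ (sumOver-++ xs ys f)) (sym (+-assoc _ _ _))

  -- Meant for `g` prepending an entry to a tuple: `f` is the weight of the longer tuple, `h` that
  -- of the shorter one, and `u` the factor of the new entry.
  sumOver-map-* : ∀ {a b} {A : Set a} {B : Set b} (g : A → B) u {f h} →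
                  (∀ x → f (g x) ≈ u * h x) →
                  ∀ xs → sumOver (map g xs) f ≈ u * sumOver xs h
  sumOver-map-* g u f∘g≈uh []       = sym (zeroʳ u)
  sumOver-map-* g u f∘g≈uh (x ∷ xs) =
    trans (+-cong (f∘g≈uh x) (sumOver-map-* g u f∘g≈uh xs)) (sym (distribˡ u _ _))

  sum-last : ∀ s (f : ℕ → Carrier) →
             ∑[ j ≤ suc s ] f (toℕ j) ≈ ∑[ j ≤ s ] f (toℕ j) + f (suc s)
  sum-last s f = trans (sum-init-last {suc s} (f ∘ toℕ)) (+-cong
    (sum-cong-≋ {suc s} (λ j → reflexive (≡.cong f (toℕ-inject₁ j))))
    (reflexive (≡.cong f (toℕ-fromℕ (suc s)))))

  -- The recurrence for generalized Stirling numbers.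

  module _ {α β : Carrier} {S : ℕ → ℕ → Carrier} (isS : IsGeneralizedStirling α β S) where

    open IsGeneralizedStirling isS

    -- The rising product of length n + 1 is expanded directly and as x + nα times the expansion of
    -- length n; independence of the falling products then equates coordinates.
    recurrence : ∀ n k → S (suc n) (suc k) ≈ S n k + (ι n * α + ι (suc k) * β) * S n (suc k)
    recurrence n k with ℕ.≤-<-connex k n
    ... | inj₁ k≤n = linComb-injective β (suc n) expansions (s≤s k≤n)
      where
      γ : Carrier
      γ = ι n * α
      expansions : linComb (suc n) (S (suc n)) (falling β)
                     ≈ₚ linComb (suc n) (next β γ (S n)) (falling β)
      expansions i = begin
        coeff (linComb (suc n) (S (suc n)) (falling β)) i  ≈⟨ expansion (suc n) i ⟨
        coeff (rising α n *ₚ (x+ γ)) i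
          ≈⟨ *-x+-cong {rising α n} {linComb n (S n) (falling β)} γ (expansion n) i ⟩
        coeff (linComb n (S n) (falling β) *ₚ (x+ γ)) i    ≈⟨ linComb-*-x+ β γ n (S n) i ⟩
        coeff (linComb n (next β γ (S n)) (falling β)) i + S n n * coeff (falling β (suc n)) i
          -- Since S(n, n+1) = 0, `next` at n + 1 is exactly S(n, n), so the extra term becomes the
          -- top term of a combination of length n + 1.
          ≈⟨ +-congˡ (*-congʳ (sym (trans
               (+-congˡ (trans (*-congˡ (vanishing (ℕ.n<1+n n))) (zeroʳ _))) (+-identityʳ _)))) ⟩
        coeff (linComb n (next β γ (S n)) (falling β)) i
          + next β γ (S n) (suc n) * coeff (falling β (suc n)) i
          ≈⟨ coeff-linComb-suc n (next β γ (S n)) (falling β) i ⟨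
        coeff (linComb (suc n) (next β γ (S n)) (falling β)) i ∎
    -- Above the diagonal every Stirling number in the recurrence is zero.
    ... | inj₂ n<k = begin
      S (suc n) (suc k)  ≈⟨ vanishing (s≤s n<k) ⟩
      0#                 ≈⟨ trans (+-identityˡ _) (zeroʳ _) ⟨
      0# + (ι n * α + ι (suc k) * β) * 0#
        ≈⟨ +-cong (vanishing n<k) (*-congˡ (vanishing (ℕ.m≤n⇒m≤1+n n<k))) ⟨
      S n k + (ι n * α + ι (suc k) * β) * S n (suc k) ∎

    -- Sums of tuple weights and the induction on s.

    module _ (k m : ℕ) where

      W : ℕ → ℕ → Carrier
      W r lo = sumOver (increasingTuples r lo k) (weight α β m r)

      -- The contribution of i₁ = i to the weight of an r-tuple.
      factor : ℕ → ℕ → Carrier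
      factor r i = (α + β) * ι i + α * (ι m - ι r)

      W-zero : ∀ lo → W 0 lo ≈ 1#
      W-zero lo = +-identityʳ 1#

      W-above : ∀ r → W (suc r) (suc k) ≈ 0#
      W-above r rewrite range-empty k = refl

      -- Tuples with i₁ = `lo` give the product; those with i₁ > `lo` give the second summand.
      W-suc : ∀ r {lo} → lo ℕ.≤ k →
              W (suc r) lo ≈ factor (suc r) lo * W r lo + W (suc r) (suc lo)
      W-suc r {lo} lo≤k rewrite range-∷ lo≤k =
        trans (sumOver-++ (map (lo Vec.∷_) (increasingTuples r lo k)) _ (weight α β m (suc r)))
              -- `refl` suffices because each factor depends on its position only through the
              -- distance r - l from the end, so deleting i₁ leaves the other factors unchanged.
              (+-congʳ (sumOver-map-* (lo Vec.∷_) (factor (suc r) lo) (λ _ → refl)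
                          (increasingTuples r lo k)))

      -- Collecting α and β turns the factor into (i + m - r)α + iβ, and the hypothesis says that i
      -- + m - r is N.
      factor≈ : ∀ {N r i} → i ℕ.+ m ≡ N ℕ.+ r → factor r i ≈ ι N * α + ι i * β
      factor≈ {N} {r} {i} i+m≡N+r = begin
        (α + β) * ι i + α * (ι m - ι r)      ≈⟨ rearrange α β (ι i) (ι m) (ι r) ⟩
        (ι i + ι m - ι r) * α + ι i * β      ≈⟨ +-congʳ (*-congʳ (+-congʳ (×-homo-+ 1# i m))) ⟨
        (ι (i ℕ.+ m) - ι r) * α + ι i * β
          ≈⟨ +-congʳ (*-congʳ (+-congʳ (reflexive (≡.cong ι i+m≡N+r)))) ⟩
        (ι (N ℕ.+ r) - ι r) * α + ι i * β    ≈⟨ +-congʳ (*-congʳ (+-congʳ (×-homo-+ 1# N r))) ⟩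
        (ι N + ι r - ι r) * α + ι i * β      ≈⟨ cancel α (ι N) (ι r) (ι i * β) ⟩
        ι N * α + ι i * β                    ∎
        where
        rearrange : ∀ α β i m r → (α + β) * i + α * (m - r) ≈ (i + m - r) * α + i * β
        rearrange α β i m r = solve 5 (λ α β i m r′ →
          (α :+ β) :* i :+ α :* (m :+ r′) := (i :+ m :+ r′) :* α :+ i :* β) refl α β i m (- r)
        cancel : ∀ α n r u → (n + r - r) * α + u ≈ n * α + u
        cancel α n r u = +-congʳ (*-congʳ
          (trans (+-assoc n r (- r)) (trans (+-congˡ (-‿inverseʳ r)) (+-identityʳ n))))

      formula : ∀ s → s ℕ.≤ k →
        S (k ℕ.+ m) k ≈ ∑[ j ≤ s ] (W (s ∸ toℕ j) (k ∸ toℕ j) * S (k ℕ.+ m ∸ s) (k ∸ toℕ j))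
      formula zero    _   = sym (trans (+-identityʳ _) (trans (*-congʳ (W-zero k)) (*-identityˡ _)))
      formula (suc s) s<k = begin
        S (k ℕ.+ m) k                                       ≈⟨ formula s (ℕ.<⇒≤ s<k) ⟩
        ∑[ j ≤ s ] (w (toℕ j) * S (k ℕ.+ m ∸ s) (k ∸ toℕ j))
          ≈⟨ sum-cong-≋ {suc s} (λ j → old-term (toℕ≤pred[n] j)) ⟩
        ∑[ j ≤ s ] (gwb (toℕ j) + u (suc (toℕ j)) * b (suc (toℕ j)))
          ≈⟨ ∑-distrib-+ {suc s} (gwb ∘ toℕ) (ub ∘ suc ∘ toℕ) ⟩
        ∑[ j ≤ s ] gwb (toℕ j) + ∑[ j ≤ s ] ub (suc (toℕ j))
          -- The reindexed sum starts at 1. Its missing term `ub 0` is zero, since no nonempty tuple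
          -- lies between k + 1 and k.
          ≈⟨ +-congˡ (trans (+-congʳ (trans (*-congʳ (W-above s)) (zeroˡ _))) (+-identityˡ _)) ⟨
        ∑[ j ≤ s ] gwb (toℕ j) + ∑[ j ≤ suc s ] ub (toℕ j)
          ≈⟨ +-congˡ (sum-last s ub) ⟩
        ∑[ j ≤ s ] gwb (toℕ j) + (∑[ j ≤ s ] ub (toℕ j) + ub (suc s))
          ≈⟨ +-assoc _ _ _ ⟨
        ∑[ j ≤ s ] gwb (toℕ j) + ∑[ j ≤ s ] ub (toℕ j) + ub (suc s)
          ≈⟨ +-congʳ (∑-distrib-+ {suc s} (gwb ∘ toℕ) (ub ∘ toℕ)) ⟨
        ∑[ j ≤ s ] (gwb (toℕ j) + ub (toℕ j)) + ub (suc s)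
          ≈⟨ +-cong (sum-cong-≋ {suc s} (λ j → new-term (toℕ≤pred[n] j))) last-term ⟨
        ∑[ j ≤ s ] vb (toℕ j) + vb (suc s)                  ≈⟨ sum-last s vb ⟨
        ∑[ j ≤ suc s ] vb (toℕ j)                           ∎
        where
        N : ℕ
        N = k ℕ.+ m ∸ suc s
        -- `w` and `v` are the coefficients for s and s + 1, and `u` is the part of `v` with i₁ > k
        -- - j. For j at most s, `u (suc j)` equals `w j`, which is what permits regrouping by the
        -- index k - j.
        w u v b g gwb ub vb : ℕ → Carrier
        w j = W (s ∸ j) (k ∸ j)
        u j = W (suc s ∸ j) (suc (k ∸ j))
        v j = W (suc s ∸ j) (k ∸ j)
        b j = S N (k ∸ j)
        g j = factor (suc (s ∸ j)) (k ∸ j)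
        gwb j = g j * w j * b j
        ub j = u j * b j
        vb j = v j * b j

        old-term : ∀ {j} → j ℕ.≤ s → w j * S (k ℕ.+ m ∸ s) (k ∸ j) ≈ gwb j + ub (suc j)
        old-term {j} j≤s = begin
          w j * S (k ℕ.+ m ∸ s) (k ∸ j)
            -- Both indices are successors because s < k and j ≤ s, so the recurrence applies.
            ≈⟨ *-congˡ (reflexive (≡.cong₂ S (ℕ.+-∸-assoc 1 (ℕ.≤-trans s<k (ℕ.m≤m+n k m))) k∸j≡)) ⟩
          w j * S (suc N) (suc (k ∸ suc j))  ≈⟨ *-congˡ (recurrence N (k ∸ suc j)) ⟩
          w j * (b (suc j) + (ι N * α + ι (suc (k ∸ suc j)) * β) * S N (suc (k ∸ suc j)))
            ≈⟨ *-congˡ (+-congˡ (reflexive (≡.cong (λ i → (ι N * α + ι i * β) * S N i) k∸j≡))) ⟨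
          w j * (b (suc j) + (ι N * α + ι (k ∸ j) * β) * b j)
            ≈⟨ *-congˡ (+-congˡ (*-congʳ (factor≈ {N} {suc (s ∸ j)} (index-balance m s<k j≤s)))) ⟨
          w j * (b (suc j) + g j * b j)      ≈⟨ expand (w j) (b (suc j)) (g j) (b j) ⟩
          g j * w j * b j + w j * b (suc j)
            ≈⟨ +-congˡ (*-congʳ (reflexive (≡.cong (W (s ∸ j)) k∸j≡))) ⟩
          gwb j + ub (suc j)                 ∎
          where
          k∸j≡ : k ∸ j ≡ suc (k ∸ suc j)
          k∸j≡ = ℕ.+-∸-assoc 1 (ℕ.≤-trans (s≤s j≤s) s<k)
          expand : ∀ w b′ g b → w * (b′ + g * b) ≈ g * w * b + w * b′
          expand = solve 4 (λ w b′ g b → w :* (b′ :+ g :* b) := g :* w :* b :+ w :* b′) refl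

        new-term : ∀ {j} → j ℕ.≤ s → vb j ≈ gwb j + ub j
        new-term {j} j≤s rewrite ℕ.+-∸-assoc 1 j≤s =
          trans (*-congʳ (W-suc (s ∸ j) (ℕ.m∸n≤m k j))) (distribʳ (b j) _ _)

        last-term : vb (suc s) ≈ ub (suc s)
        -- For j = s + 1 both tuple sums run over the empty tuple alone and coincide.
        last-term rewrite ℕ.n∸n≡0 s = refl

theorem8 : ∀ {c ℓ} (R : CommutativeRing c ℓ) →
    let open CommutativeRing R
        open GeneralizedStirling R in
    (α β : Carrier) (S : ℕ → ℕ → Carrier) → IsGeneralizedStirling α β S →
    (k m s : ℕ) → s ℕ.≤ k →
    S (k ℕ.+ m) k
      ≈ ∑[ j ≤ s ]
          ( sumOver (increasingTuples (s ∸ toℕ j) (k ∸ toℕ j) k)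
                    (weight α β m (s ∸ toℕ j))
          * S (k ℕ.+ m ∸ s) (k ∸ toℕ j) )
theorem8 R α β S isS k m s s≤k = formula R isS k m s s≤k
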